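{- For every integer $d\geqslant 2$, we have $n(2,d)\geqslant b(d)$.
   Context: A box in $\mathbb{R}^d$ is an axis-parallel $d$-dimensional cuboid (a product of $d$ non-degenerate closed intervals). Two boxes in $\mathbb{R}^d$ are $k$-neighborly if their intersection has dimension at least $d-k$ and at most $d-1$. $n(k,d)$ denotes the maximum number of boxes in $\mathbb{R}^d$ that are pairwise $k$-neighborly. Let $(a(n))_{n\geqslant 1}$ be the non-decreasing sequence of integers that lists every integer $m\geqslant 2$, where each $m$ of the form $3\cdot 2^r$ ($r\geqslant 0$ an integer) appears exactly twice and every other $m\geqslant 2$ appears exactly once; thus $a=2,3,3,4,5,6,6,7,8,9,10,11,12,12,13,\dots$. Define $b(2)=4$ and $b(d)=4+a(1)+a(2)+\cdots+a(d-2)$ for $d\geqslant 3$. -}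

module Defs where

open import Data.Bool using (Bool; true; false; if_then_else_; _∧_; not)
open import Data.Nat using (ℕ; zero; suc; _+_; _*_; _∸_; _^_; _≡ᵇ_) renaming (_≤_ to _≤ℕ_; _<_ to _<ℕ_)
open import Data.List using (List; length; filter; map; upTo)
open import Data.Bool.ListAction using (any)
open import Data.Nat.ListAction using (sum)
open import Data.Fin using (Fin)
open import Data.List using (allFin)
open import Data.Integer using (ℤ; _≤_; _<_; _⊔_; _⊓_; _<?_)
open import Data.Product using (_×_)

-- isThreeTwoPow m = true iff m = 3 * 2^r for some r ≥ 0
-- (a witness must satisfy r < m since 2^r > r, so the search is bounded)
isThreeTwoPow : ℕ → Bool
isThreeTwoPow m = any (λ r → (3 * 2 ^ r) ≡ᵇ m) (upTo m)

-- aux k m used : walk k steps along the sequence starting at value m;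
-- 'used' records whether the first copy of a doubled value m was already listed.
aux : ℕ → ℕ → Bool → ℕ
aux zero    m used = m
aux (suc k) m used =
  if isThreeTwoPow m ∧ not used then aux k m true else aux k (suc m) false

-- a (n) for n ≥ 1 (a 0 is a dummy value, never used): 2,3,3,4,5,6,6,7,...
a : ℕ → ℕ
a n = aux (n ∸ 1) 2 false

b : ℕ → ℕ
b d = 4 + sum (map (λ i → a (suc i)) (upTo (d ∸ 2)))

record Box (d : ℕ) : Set where
  field
    lo hi  : Fin d → ℤ
    nondeg : ∀ i → lo i < hi i
open Box public

-- On coordinate i the intersection of the two edge intervals is
-- [lo B i ⊔ lo C i , hi B i ⊓ hi C i].
-- The boxes intersect iff every such interval is nonempty.
Intersect : ∀ {d} → Box d → Box d → Set
Intersect B C = ∀ i → lo B i ⊔ lo C i ≤ hi B i ⊓ hi C i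

-- dimension of the (nonempty) intersection = number of coordinates
-- on which the intersection interval is non-degenerate
interDim : ∀ {d} → Box d → Box d → ℕ
interDim {d} B C =
  length (filter (λ i → lo B i ⊔ lo C i <? hi B i ⊓ hi C i) (allFin d))

Neighborly : ℕ → (d : ℕ) → Box d → Box d → Set
Neighborly k d B C =
  Intersect B C × (d ∸ k ≤ℕ interDim B C) × (interDim B C <ℕ d)

{-# OPTIONS --safe #-}

-- Encode boxes as words over {o, i, ⋆}, standing for the edges [0,1], [1,2], [0,2].
-- Two boxes meet in dimension d minus the number of positions where one word has o
-- and the other i, so we need words that pairwise clash in one or two positions.
--
-- The construction is a binary tree of depth j.  Each subtree carries a 1-neighborly
-- code C on its own m coordinates (m + 1 words) and a 2-neighborly code A on m + e
-- coordinates, the e "level" coordinates being shared by all subtrees of the same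
-- height.  Every level part is taken from the comb code i⋆⋆⋯, oi⋆⋯, ooi⋯, …, ooo⋯o,
-- so two level parts clash at most once.  A leaf is a product of two combs.  A node
-- has a new coordinate and a new level coordinate; its code A consists of
--   o A₁ ⋆ | o,    i ⋆ A₂ | o,    ⋆ C₁ C₂ | i ⋆ ⋯ ⋆,
-- hence has |A₁| + |A₂| + |C₁||C₂| words.  If the leaves have sizes s₁, s₂, …, with
-- sum M, and e = j + 2, the result lives in dimension M + j + 1 and has
-- Σ_{p<q} s_p s_q + 3M words.  Letting the 2^j leaf sizes grow one at a time
-- from 2 to 3 and then from 3 to 4 adds 2^(j+1)+1, …, 3·2^j and
-- 3·2^j, …, 2^(j+2)-1 words, and replacing all leaves of size 4 by nodes with two
-- leaves of size 2 adds 2^(j+2): these are the terms of the sequence a.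
module Submission where

open import Defs
open import Data.Bool using (Bool; true; false; if_then_else_; _∧_; not; T)
open import Data.Bool.Properties using (T-≡; ¬-not)
open import Data.Fin using (Fin; zero; suc)
open import Data.Fin.Properties using (+↔⊎; *↔×)
open import Data.Integer using (ℤ; _⊔_; _⊓_; +≤+; +<+; _<?_) renaming (+_ to pos; _≤_ to _≤ℤ_; _<_ to _<ℤ_)
open import Data.List using ([]; _∷_; length; filter; map; upTo; tabulate; allFin)
open import Data.List.Membership.Propositional using (lose; find)
open import Data.List.Membership.Propositional.Properties using (∈-upTo⁺)
open import Data.List.Properties using (upTo-∷ʳ; map-++; map-tabulate)
open import Data.List.Relation.Unary.Any.Properties using (any⁺; any⁻)
open import Data.Nat using (ℕ; zero; suc; _+_; _*_; _∸_; _^_; _≥_; _≤_; _<_; z≤n; s≤s; _≡ᵇ_; _≤?_)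
open import Data.Nat.GeneralisedArithmetic using (fold)
open import Data.Nat.ListAction using (sum)
open import Data.Nat.ListAction.Properties using (sum-++)
open import Data.Nat.Properties hiding (_<?_)
open import Data.Nat.Tactic.RingSolver using (solve-∀)
open import Data.Product using (Σ; ∃; _×_; _,_; proj₁; proj₂)
open import Data.Product.Function.NonDependent.Propositional using (_×-↔_)
open import Data.Sum using (_⊎_; inj₁; inj₂)
open import Data.Sum.Function.Propositional using (_⊎-↔_)
open import Data.Vec using (Vec; []; _∷_; _++_; replicate; lookup)
open import Function using (_∘_; _↔_; Injection; Equivalence)
open import Function.Construct.Composition using (_↔-∘_)
open import Function.Construct.Identity using (↔-id)
open import Function.Properties.Inverse using (↔⇒↣)
open import Level using (0ℓ)
open import Relation.Nullary using (¬_; does; yes; no; contradiction)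
open import Relation.Unary using (Pred; Decidable)
open import Relation.Binary.PropositionalEquality using (_≡_; _≢_; refl; sym; trans; cong; cong₂; subst; subst₂; module ≡-Reasoning)

-- Words and boxes

data Letter : Set where
  o i ⋆ : Letter

Word : ℕ → Set
Word = Vec Letter

clash : Letter → Letter → ℕ
clash o i = 1
clash i o = 1
clash _ _ = 0

dist : ∀ {d} → Word d → Word d → ℕ
dist []      []      = 0
dist (x ∷ u) (y ∷ v) = clash x y + dist u v

left right : Letter → ℤ
left o = pos 0
left i = pos 1
left ⋆ = pos 0
right o = pos 1
right i = pos 2
right ⋆ = pos 2

left<right : ∀ x → left x <ℤ right x
left<right o = +<+ (s≤s z≤n)
left<right i = +<+ (s≤s (s≤s z≤n))
left<right ⋆ = +<+ (s≤s z≤n)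

-- All three edges contain the point 1, so boxes of words always intersect.
edges-meet : ∀ x y → left x ⊔ left y ≤ℤ right x ⊓ right y
edges-meet o o = +≤+ z≤n
edges-meet o i = +≤+ (s≤s z≤n)
edges-meet o ⋆ = +≤+ z≤n
edges-meet i o = +≤+ (s≤s z≤n)
edges-meet i i = +≤+ (s≤s z≤n)
edges-meet i ⋆ = +≤+ (s≤s z≤n)
edges-meet ⋆ o = +≤+ z≤n
edges-meet ⋆ i = +≤+ (s≤s z≤n)
edges-meet ⋆ ⋆ = +≤+ z≤n

box : ∀ {d} → Word d → Box d
box u = record
  { lo     = λ k → left (lookup u k)
  ; hi     = λ k → right (lookup u k)
  ; nondeg = λ k → left<right (lookup u k)
  }

length-filter-map : ∀ {A B : Set} {P : Pred B 0ℓ} (P? : Decidable P) (f : A → B) xs →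
  length (filter P? (map f xs)) ≡ length (filter (P? ∘ f) xs)
length-filter-map P? f []       = refl
length-filter-map P? f (x ∷ xs) with does (P? (f x))
... | true  = cong suc (length-filter-map P? f xs)
... | false = length-filter-map P? f xs

length-filter-allFin : ∀ {d} {P : Pred (Fin (suc d)) 0ℓ} (P? : Decidable P) →
  length (filter P? (tabulate suc)) ≡ length (filter (P? ∘ suc) (allFin d))
length-filter-allFin {d} P? =
  trans (cong (length ∘ filter P?) (sym (map-tabulate (λ k → k) suc)))
        (length-filter-map P? suc (allFin d))

Overlap : ∀ {d} → Box d → Box d → Pred (Fin d) 0ℓ
Overlap B C k = lo B k ⊔ lo C k <ℤ hi B k ⊓ hi C k

overlap? : ∀ {d} (B C : Box d) → Decidable (Overlap B C)
overlap? B C k = lo B k ⊔ lo C k <? hi B k ⊓ hi C k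

-- Only the edges of `o` and `i` meet in a single point; every other pair overlaps in an interval.
-- So each coordinate is counted by exactly one of the two summands.
interDim+dist : ∀ {d} (u v : Word d) → interDim (box u) (box v) + dist u v ≡ d
interDim+dist [] [] = refl
interDim+dist {suc d} (x ∷ u) (y ∷ v) = cons x y
  where
  tail : ∀ x y → length (filter (overlap? (box (x ∷ u)) (box (y ∷ v))) (tabulate suc)) + dist u v ≡ d
  tail x y = trans (cong (_+ dist u v) (length-filter-allFin (overlap? (box (x ∷ u)) (box (y ∷ v)))))
                   (interDim+dist u v)
  cons : ∀ x y → interDim (box (x ∷ u)) (box (y ∷ v)) + dist (x ∷ u) (y ∷ v) ≡ suc d
  cons o i = trans (+-suc _ _) (cong suc (tail o i))
  cons i o = trans (+-suc _ _) (cong suc (tail i o))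
  cons o o = cong suc (tail o o)
  cons o ⋆ = cong suc (tail o ⋆)
  cons i i = cong suc (tail i i)
  cons i ⋆ = cong suc (tail i ⋆)
  cons ⋆ o = cong suc (tail ⋆ o)
  cons ⋆ i = cong suc (tail ⋆ i)
  cons ⋆ ⋆ = cong suc (tail ⋆ ⋆)

box-neighborly : ∀ {d} (u v : Word d) → dist u v ≤ 2 → dist u v ≢ 0 → Neighborly 2 d (box u) (box v)
box-neighborly {d} u v ≤2 ≢0 = (λ k → edges-meet (lookup u k) (lookup v k)) , lower , upper
  where
  n = interDim (box u) (box v)
  open ≤-Reasoning
  lower : d ∸ 2 ≤ n
  lower = begin
    d ∸ 2                    ≤⟨ ∸-monoʳ-≤ d ≤2 ⟩
    d ∸ dist u v             ≡⟨ cong (_∸ dist u v) (sym (interDim+dist u v)) ⟩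
    n + dist u v ∸ dist u v  ≡⟨ m+n∸n≡m n (dist u v) ⟩
    n                        ∎
  upper : n < d
  upper = begin-strict
    n             <⟨ m<m+n n (n≢0⇒n>0 ≢0) ⟩
    n + dist u v  ≡⟨ interDim+dist u v ⟩
    d             ∎

-- Distances

stars : ∀ d → Word d
stars d = replicate d ⋆

clash-comm : ∀ x y → clash x y ≡ clash y x
clash-comm o o = refl
clash-comm o i = refl
clash-comm o ⋆ = refl
clash-comm i o = refl
clash-comm i i = refl
clash-comm i ⋆ = refl
clash-comm ⋆ o = refl
clash-comm ⋆ i = refl
clash-comm ⋆ ⋆ = refl

dist-comm : ∀ {d} (u v : Word d) → dist u v ≡ dist v u
dist-comm []      []      = refl
dist-comm (x ∷ u) (y ∷ v) = cong₂ _+_ (clash-comm x y) (dist-comm u v)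

dist-starsˡ : ∀ {d} (v : Word d) → dist (stars d) v ≡ 0
dist-starsˡ []      = refl
dist-starsˡ (y ∷ v) = dist-starsˡ v

dist-starsʳ : ∀ {d} (u : Word d) → dist u (stars d) ≡ 0
dist-starsʳ u = trans (dist-comm u _) (dist-starsˡ u)

dist-++ : ∀ {m n} (u u′ : Word m) (v v′ : Word n) →
  dist (u ++ v) (u′ ++ v′) ≡ dist u u′ + dist v v′
dist-++ []      []        v v′ = refl
dist-++ (x ∷ u) (x′ ∷ u′) v v′ =
  trans (cong (clash x x′ +_) (dist-++ u u′ v v′)) (sym (+-assoc (clash x x′) _ _))

comb : ∀ n → Fin (suc n) → Word n
comb zero    zero    = []
comb (suc n) zero    = i ∷ stars n
comb (suc n) (suc k) = o ∷ comb n k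

-- The leading `i` of one word meets an `o` of the other; before that position both words read `o`,
-- and after it the first is all `⋆`.
comb≤1 : ∀ n k l → dist (comb n k) (comb n l) ≤ 1
comb≤1 zero    zero    zero    = z≤n
comb≤1 (suc n) zero    zero    = ≤-trans (≤-reflexive (dist-starsˡ (stars n))) z≤n
comb≤1 (suc n) zero    (suc l) = s≤s (≤-reflexive (dist-starsˡ (comb n l)))
comb≤1 (suc n) (suc k) zero    = s≤s (≤-reflexive (dist-starsʳ (comb n k)))
comb≤1 (suc n) (suc k) (suc l) = comb≤1 n k l

comb-injective : ∀ n k l → dist (comb n k) (comb n l) ≡ 0 → k ≡ l
comb-injective zero    zero    zero    _  = refl
comb-injective (suc n) zero    zero    _  = refl
comb-injective (suc n) (suc k) (suc l) eq = cong suc (comb-injective n k l eq)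

-- Tree codes

-- The index types stay abstract, with sizes given by bijections, so that a node can form sums and
-- products of them. The invariant `tip-stem≤1` is what keeps cross words close to both subtrees one
-- height further up.
record TreeCode (m e S : ℕ) : Set₁ where
  field
    A C         : Set
    A-card      : Fin S ↔ A
    C-card      : Fin (suc m) ↔ C
    tip         : C → Word m
    stem        : A → Word m
    level       : A → Fin (suc e)

  gap : A → A → ℕ
  gap a b = dist (stem a) (stem b) + dist (comb e (level a)) (comb e (level b))

  field
    tip≤1         : ∀ x y → dist (tip x) (tip y) ≤ 1
    tip-injective : ∀ x y → dist (tip x) (tip y) ≡ 0 → x ≡ y
    gap≤2         : ∀ a b → gap a b ≤ 2
    gap-injective : ∀ a b → gap a b ≡ 0 → a ≡ b
    tip-stem≤1    : ∀ x a → dist (tip x) (stem a) ≤ 1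

leaf : ∀ m e → TreeCode m e (suc m * suc e)
leaf m e = record
  { A             = Fin (suc m) × Fin (suc e)
  ; C             = Fin (suc m)
  ; A-card        = *↔×
  ; C-card        = ↔-id _
  ; tip           = comb m
  ; stem          = comb m ∘ proj₁
  ; level         = proj₂
  ; tip≤1         = comb≤1 m
  ; tip-injective = comb-injective m
  ; gap≤2         = λ (k , l) (k′ , l′) → +-mono-≤ (comb≤1 m k k′) (comb≤1 e l l′)
  ; gap-injective = λ (k , l) (k′ , l′) eq →
      cong₂ _,_ (comb-injective m k k′ (m+n≡0⇒m≡0 _ eq))
                (comb-injective e l l′ (m+n≡0⇒n≡0 (dist (comb m k) (comb m k′)) eq))
  ; tip-stem≤1    = λ x (k , _) → comb≤1 m x k
  }

module Node {m₁ m₂ e S₁ S₂} (X : TreeCode m₁ e S₁) (Y : TreeCode m₂ e S₂) where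
  private
    module X = TreeCode X
    module Y = TreeCode Y

  A C : Set
  A = X.A ⊎ (Y.A ⊎ (X.C × Y.C))
  C = X.C ⊎ Y.C

  tip : C → Word (suc (m₁ + m₂))
  tip (inj₁ x) = o ∷ X.tip x ++ stars m₂
  tip (inj₂ y) = i ∷ stars m₁ ++ Y.tip y

  stem : A → Word (suc (m₁ + m₂))
  stem (inj₁ a)              = o ∷ X.stem a ++ stars m₂
  stem (inj₂ (inj₁ b))       = i ∷ stars m₁ ++ Y.stem b
  stem (inj₂ (inj₂ (x , y))) = ⋆ ∷ X.tip x ++ Y.tip y

  level : A → Fin (suc (suc e))
  level (inj₁ a)        = suc (X.level a)
  level (inj₂ (inj₁ b)) = suc (Y.level b)
  level (inj₂ (inj₂ _)) = zero

  ++-starsʳ : (u u′ : Word m₁) → dist (u ++ stars m₂) (u′ ++ stars m₂) ≡ dist u u′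
  ++-starsʳ u u′ = trans (dist-++ u u′ _ _) (trans (cong (dist u u′ +_) (dist-starsˡ (stars m₂))) (+-identityʳ _))

  ++-starsˡ : (v v′ : Word m₂) → dist (stars m₁ ++ v) (stars m₁ ++ v′) ≡ dist v v′
  ++-starsˡ v v′ = trans (dist-++ (stars m₁) _ v v′) (cong (_+ dist v v′) (dist-starsˡ (stars m₁)))

  -- In every position at least one of the two words is `⋆`.
  ++-cross : (u : Word m₁) (v : Word m₂) → dist (u ++ stars m₂) (stars m₁ ++ v) ≡ 0
  ++-cross u v = trans (dist-++ u _ _ v) (cong₂ _+_ (dist-starsʳ u) (dist-starsˡ v))

  ++-fullˡ : (u u′ : Word m₁) (v : Word m₂) → dist (u ++ v) (u′ ++ stars m₂) ≡ dist u u′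
  ++-fullˡ u u′ v = trans (dist-++ u u′ v _) (trans (cong (dist u u′ +_) (dist-starsʳ v)) (+-identityʳ _))

  ++-fullʳ : (u : Word m₁) (v v′ : Word m₂) → dist (u ++ v) (stars m₁ ++ v′) ≡ dist v v′
  ++-fullʳ u v v′ = trans (dist-++ u _ v v′) (cong (_+ dist v v′) (dist-starsʳ u))

  gap : A → A → ℕ
  gap a b = dist (stem a) (stem b) + dist (comb (suc e) (level a)) (comb (suc e) (level b))

  gap-comm : ∀ a b → gap a b ≡ gap b a
  gap-comm a b = cong₂ _+_ (dist-comm (stem a) _) (dist-comm (comb (suc e) (level a)) _)

  tip≤1 : ∀ x y → dist (tip x) (tip y) ≤ 1
  tip≤1 (inj₁ x) (inj₁ y) = ≤-trans (≤-reflexive (++-starsʳ (X.tip x) _)) (X.tip≤1 x y)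
  tip≤1 (inj₁ x) (inj₂ y) = s≤s (≤-reflexive (++-cross (X.tip x) (Y.tip y)))
  tip≤1 (inj₂ x) (inj₁ y) =
    s≤s (≤-reflexive (trans (dist-comm (stars m₁ ++ Y.tip x) _) (++-cross (X.tip y) (Y.tip x))))
  tip≤1 (inj₂ x) (inj₂ y) = ≤-trans (≤-reflexive (++-starsˡ (Y.tip x) _)) (Y.tip≤1 x y)

  tip-injective : ∀ x y → dist (tip x) (tip y) ≡ 0 → x ≡ y
  -- For tips from opposite subtrees the new coordinate makes the distance a successor, so those
  -- clauses are absent.
  tip-injective (inj₁ x) (inj₁ y) eq = cong inj₁ (X.tip-injective x y (trans (sym (++-starsʳ (X.tip x) _)) eq))
  tip-injective (inj₂ x) (inj₂ y) eq = cong inj₂ (Y.tip-injective x y (trans (sym (++-starsˡ (Y.tip x) _)) eq))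

  -- The level coordinate i of a cross word raises its distance to the other words by
  -- exactly one; on the remaining level coordinates it is ⋆.
  gap-crossˡ : ∀ a x y → gap (inj₂ (inj₂ (x , y))) (inj₁ a) ≡ suc (dist (X.tip x) (X.stem a))
  gap-crossˡ a x y =
    trans (cong₂ _+_ (++-fullˡ (X.tip x) (X.stem a) (Y.tip y)) (cong suc (dist-starsˡ (comb e (X.level a)))))
          (+-comm _ 1)

  gap-crossʳ : ∀ b x y → gap (inj₂ (inj₂ (x , y))) (inj₂ (inj₁ b)) ≡ suc (dist (Y.tip y) (Y.stem b))
  gap-crossʳ b x y =
    trans (cong₂ _+_ (++-fullʳ (X.tip x) (Y.tip y) (Y.stem b)) (cong suc (dist-starsˡ (comb e (Y.level b)))))
          (+-comm _ 1)

  -- Cross words share one level word and have `⋆` in the new coordinate, so their distance is that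
  -- of a product of two 1-neighborly codes.
  gap-cross : ∀ x y x′ y′ → gap (inj₂ (inj₂ (x , y))) (inj₂ (inj₂ (x′ , y′))) ≡ dist (X.tip x) (X.tip x′) + dist (Y.tip y) (Y.tip y′)
  gap-cross x y x′ y′ = trans (cong₂ _+_ (dist-++ (X.tip x) _ _ _) (dist-starsˡ (stars e))) (+-identityʳ _)

  gap-left : ∀ a a′ → gap (inj₁ a) (inj₁ a′) ≡ X.gap a a′
  gap-left a a′ = cong (_+ _) (++-starsʳ (X.stem a) _)

  gap-right : ∀ b b′ → gap (inj₂ (inj₁ b)) (inj₂ (inj₁ b′)) ≡ Y.gap b b′
  gap-right b b′ = cong (_+ _) (++-starsˡ (Y.stem b) _)

  -- The stems use disjoint coordinates apart from the new one, which contributes one clash; beyond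
  -- it only the shared level coordinates can clash.
  gap-left-right : ∀ a b → gap (inj₁ a) (inj₂ (inj₁ b)) ≡ suc (dist (comb e (X.level a)) (comb e (Y.level b)))
  gap-left-right a b = cong (λ n → suc (n + _)) (++-cross (X.stem a) (Y.stem b))

  gap-left-right≤2 : ∀ a b → gap (inj₁ a) (inj₂ (inj₁ b)) ≤ 2
  gap-left-right≤2 a b = ≤-trans (≤-reflexive (gap-left-right a b)) (s≤s (comb≤1 e _ _))

  gap-crossˡ≤2 : ∀ a x y → gap (inj₂ (inj₂ (x , y))) (inj₁ a) ≤ 2
  gap-crossˡ≤2 a x y = ≤-trans (≤-reflexive (gap-crossˡ a x y)) (s≤s (X.tip-stem≤1 x a))

  gap-crossʳ≤2 : ∀ b x y → gap (inj₂ (inj₂ (x , y))) (inj₂ (inj₁ b)) ≤ 2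
  gap-crossʳ≤2 b x y = ≤-trans (≤-reflexive (gap-crossʳ b x y)) (s≤s (Y.tip-stem≤1 y b))

  gap≤2 : ∀ a b → gap a b ≤ 2
  gap≤2 (inj₁ a) (inj₁ a′) = ≤-trans (≤-reflexive (gap-left a a′)) (X.gap≤2 a a′)
  gap≤2 (inj₁ a) (inj₂ (inj₁ b)) = gap-left-right≤2 a b
  gap≤2 p@(inj₁ a) q@(inj₂ (inj₂ (x , y))) = ≤-trans (≤-reflexive (gap-comm p q)) (gap-crossˡ≤2 a x y)
  gap≤2 p@(inj₂ (inj₁ b)) q@(inj₁ a) = ≤-trans (≤-reflexive (gap-comm p q)) (gap-left-right≤2 a b)
  gap≤2 (inj₂ (inj₁ b)) (inj₂ (inj₁ b′)) = ≤-trans (≤-reflexive (gap-right b b′)) (Y.gap≤2 b b′)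
  gap≤2 p@(inj₂ (inj₁ b)) q@(inj₂ (inj₂ (x , y))) = ≤-trans (≤-reflexive (gap-comm p q)) (gap-crossʳ≤2 b x y)
  gap≤2 (inj₂ (inj₂ (x , y))) (inj₁ a) = gap-crossˡ≤2 a x y
  gap≤2 (inj₂ (inj₂ (x , y))) (inj₂ (inj₁ b)) = gap-crossʳ≤2 b x y
  gap≤2 (inj₂ (inj₂ (x , y))) (inj₂ (inj₂ (x′ , y′))) =
    ≤-trans (≤-reflexive (gap-cross x y x′ y′)) (+-mono-≤ (X.tip≤1 x x′) (Y.tip≤1 y y′))

  gap-injective : ∀ a b → gap a b ≡ 0 → a ≡ b
  gap-injective (inj₁ a) (inj₁ a′) eq = cong inj₁ (X.gap-injective a a′ (trans (sym (gap-left a a′)) eq))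
  gap-injective (inj₂ (inj₁ b)) (inj₂ (inj₁ b′)) eq =
    cong (inj₂ ∘ inj₁) (Y.gap-injective b b′ (trans (sym (gap-right b b′)) eq))
  gap-injective (inj₂ (inj₂ (x , y))) (inj₂ (inj₂ (x′ , y′))) eq =
    cong (inj₂ ∘ inj₂) (cong₂ _,_ (X.tip-injective x x′ (m+n≡0⇒m≡0 _ eq′))
                                  (Y.tip-injective y y′ (m+n≡0⇒n≡0 (dist (X.tip x) (X.tip x′)) eq′)))
    where eq′ = trans (sym (gap-cross x y x′ y′)) eq
  -- The clash with a cross word sits in the level part, behind a stuck stem distance, so the
  -- successor has to be exposed by rewriting.
  gap-injective p@(inj₁ a) q@(inj₂ (inj₂ (x , y))) eq
    with () ← trans (sym eq) (trans (gap-comm p q) (gap-crossˡ a x y))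
  gap-injective p@(inj₂ (inj₁ b)) q@(inj₂ (inj₂ (x , y))) eq
    with () ← trans (sym eq) (trans (gap-comm p q) (gap-crossʳ b x y))
  gap-injective (inj₂ (inj₂ (x , y))) (inj₁ a) eq with () ← trans (sym eq) (gap-crossˡ a x y)
  gap-injective (inj₂ (inj₂ (x , y))) (inj₂ (inj₁ b)) eq with () ← trans (sym eq) (gap-crossʳ b x y)

  -- Words of opposite subtrees clash only in the new coordinate. A cross stem has `⋆` there and
  -- restricts to a tip on each side, which leaves the distance of two tips of one subtree.
  tip-stem≤1 : ∀ x a → dist (tip x) (stem a) ≤ 1
  tip-stem≤1 (inj₁ x) (inj₁ a) = ≤-trans (≤-reflexive (++-starsʳ (X.tip x) _)) (X.tip-stem≤1 x a)
  tip-stem≤1 (inj₁ x) (inj₂ (inj₁ b)) = s≤s (≤-reflexive (++-cross (X.tip x) (Y.stem b)))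
  tip-stem≤1 (inj₁ x) (inj₂ (inj₂ (x′ , y′))) =
    ≤-trans (≤-reflexive (trans (dist-comm (X.tip x ++ stars m₂) _) (++-fullˡ (X.tip x′) (X.tip x) (Y.tip y′))))
            (X.tip≤1 x′ x)
  tip-stem≤1 (inj₂ y) (inj₁ a) =
    s≤s (≤-reflexive (trans (dist-comm (stars m₁ ++ Y.tip y) _) (++-cross (X.stem a) (Y.tip y))))
  tip-stem≤1 (inj₂ y) (inj₂ (inj₁ b)) = ≤-trans (≤-reflexive (++-starsˡ (Y.tip y) _)) (Y.tip-stem≤1 y b)
  tip-stem≤1 (inj₂ y) (inj₂ (inj₂ (x′ , y′))) =
    ≤-trans (≤-reflexive (trans (dist-comm (stars m₁ ++ Y.tip y) _) (++-fullʳ (X.tip x′) (Y.tip y′) (Y.tip y))))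
            (Y.tip≤1 y′ y)

  node : TreeCode (suc (m₁ + m₂)) (suc e) (S₁ + (S₂ + suc m₁ * suc m₂))
  node = record
    { A             = A
    ; C             = C
    ; A-card        = (X.A-card ⊎-↔ ((Y.A-card ⊎-↔ ((X.C-card ×-↔ Y.C-card) ↔-∘ *↔×)) ↔-∘ +↔⊎)) ↔-∘ +↔⊎
    ; C-card        = subst (λ n → Fin n ↔ C) (cong suc (+-suc m₁ m₂)) ((X.C-card ⊎-↔ Y.C-card) ↔-∘ +↔⊎)
    ; tip           = tip
    ; stem          = stem
    ; level         = level
    ; tip≤1         = tip≤1
    ; tip-injective = tip-injective
    ; gap≤2         = gap≤2
    ; gap-injective = gap-injective
    ; tip-stem≤1    = tip-stem≤1
    }

open Node using (node)

-- From tree codes to families of boxes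

NeighborlyFamily : ℕ → ℕ → Set
NeighborlyFamily S d = Σ (Fin S → Box d) (λ F → ∀ k l → k ≢ l → Neighborly 2 d (F k) (F l))

family : ∀ {m e S} → TreeCode m e S → NeighborlyFamily S (m + e)
family {m} {e} {S} X = box ∘ word , λ k l k≢l → box-neighborly (word k) (word l)
    (≤-trans (≤-reflexive (dist-word k l)) (gap≤2 (to k) (to l)))
    (λ eq → k≢l (injective (gap-injective (to k) (to l) (trans (sym (dist-word k l)) eq))))
  where
  open TreeCode X
  open Injection (↔⇒↣ A-card) using (to; injective)
  word : Fin S → Word (m + e)
  word k = stem (to k) ++ comb e (level (to k))
  dist-word : ∀ k l → dist (word k) (word l) ≡ gap (to k) (to l)
  dist-word k l = dist-++ (stem (to k)) _ _ _

-- Balanced trees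

-- The sum M of the leaf sizes and the sum of their squares.
total squares : ℕ → ℕ → ℕ → ℕ
total   p u w = suc p * w + suc (suc p) * u
squares p u w = suc p * suc p * w + suc (suc p) * suc (suc p) * u

-- A tree of depth j with w leaves of size p + 1 and u leaves of size p + 2.  The last
-- field is S = Σ_{x<y} sₓ s_y + 3M, doubled so as to involve only M and Σ sₓ².
record Balanced (p j u w : ℕ) : Set₁ where
  field
    {dim size}  : ℕ
    code        : TreeCode dim (j + 2) size
    dim-total   : suc dim ≡ total p u w
    size-total  : 2 * size + squares p u w ≡ suc dim * suc dim + 6 * suc dim

-- Two level coordinates give three comb words, so a leaf of size s has 3s words; this is the source
-- of the term 3M.
balanced-leaf : ∀ p → Balanced p 0 0 1
balanced-leaf p = record { code = leaf p 2 ; dim-total = dim≡ p ; size-total = size≡ p }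
  where
  dim≡ : ∀ p → suc p ≡ suc p * 1 + suc (suc p) * 0
  dim≡ = solve-∀
  size≡ : ∀ p → 2 * (suc p * 3) + (suc p * suc p * 1 + suc (suc p) * suc (suc p) * 0) ≡ suc p * suc p + 6 * suc p
  size≡ = solve-∀

balanced-leaf⁺ : ∀ p → Balanced p 0 1 0
balanced-leaf⁺ p = record { code = leaf (suc p) 2 ; dim-total = dim≡ p ; size-total = size≡ p }
  where
  dim≡ : ∀ p → suc (suc p) ≡ suc p * 0 + suc (suc p) * 1
  dim≡ = solve-∀
  size≡ : ∀ p → 2 * (suc (suc p) * 3) + (suc p * suc p * 0 + suc (suc p) * suc (suc p) * 1) ≡ suc (suc p) * suc (suc p) + 6 * suc (suc p)
  size≡ = solve-∀

-- The number of cross words is M₁M₂, and twice this is the mixed term of (M₁ + M₂)²; all other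
-- terms are additive.
balanced-node : ∀ {p j u₁ w₁ u₂ w₂} → Balanced p j u₁ w₁ → Balanced p j u₂ w₂ →
  Balanced p (suc j) (u₁ + u₂) (w₁ + w₂)
balanced-node {p} {j} {u₁} {w₁} {u₂} {w₂} X Y = record
  { code       = node X.code Y.code
  ; dim-total  = trans (cong suc (sym (+-suc X.dim Y.dim)))
                   (trans (cong₂ _+_ X.dim-total Y.dim-total) (total-+ p u₁ w₁ u₂ w₂))
  ; size-total = trans (regroup p X.size Y.size X.dim Y.dim u₁ w₁ u₂ w₂)
                   (trans (cong (_+ 2 * (suc X.dim * suc Y.dim)) (cong₂ _+_ X.size-total Y.size-total))
                          (square-+ X.dim Y.dim))
  }
  where
  module X = Balanced X
  module Y = Balanced Y
  total-+ : ∀ p u₁ w₁ u₂ w₂ →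
    (suc p * w₁ + suc (suc p) * u₁) + (suc p * w₂ + suc (suc p) * u₂) ≡ suc p * (w₁ + w₂) + suc (suc p) * (u₁ + u₂)
  total-+ = solve-∀
  regroup : ∀ p s t m n u₁ w₁ u₂ w₂ →
    2 * (s + (t + suc m * suc n)) + (suc p * suc p * (w₁ + w₂) + suc (suc p) * suc (suc p) * (u₁ + u₂)) ≡
    ((2 * s + (suc p * suc p * w₁ + suc (suc p) * suc (suc p) * u₁)) + (2 * t + (suc p * suc p * w₂ + suc (suc p) * suc (suc p) * u₂))) + 2 * (suc m * suc n)
  regroup = solve-∀
  square-+ : ∀ m n → ((suc m * suc m + 6 * suc m) + (suc n * suc n + 6 * suc n)) + 2 * (suc m * suc n) ≡
    suc (suc (m + n)) * suc (suc (m + n)) + 6 * suc (suc (m + n))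
  square-+ = solve-∀

-- Large leaves fill the left subtree first. The size depends only on `u` and `w`, so any
-- distribution would serve.
balanced : ∀ p j u w → u + w ≡ 2 ^ j → Balanced p j u w
balanced p zero    zero          .1       refl = balanced-leaf p
balanced p zero    (suc zero)    zero    refl = balanced-leaf⁺ p
balanced p (suc j) u w eq with u ≤? 2 ^ j
... | yes u≤ = subst₂ (Balanced p (suc j)) (+-identityʳ u) w≡
                 (balanced-node (balanced p j u (2 ^ j ∸ u) (m+[n∸m]≡n u≤)) (balanced p j 0 (2 ^ j) refl))
  where
  w≡ : 2 ^ j ∸ u + 2 ^ j ≡ w
  w≡ = +-cancelˡ-≡ u _ _ (trans (sym (+-assoc u _ _))
         (trans (cong₂ _+_ (m+[n∸m]≡n u≤) (sym (+-identityʳ (2 ^ j)))) (sym eq)))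
... | no u≰ = subst (λ x → Balanced p (suc j) x w) (m+[n∸m]≡n 2^j≤u)
                (balanced-node (balanced p j (2 ^ j) 0 (+-identityʳ _)) (balanced p j (u ∸ 2 ^ j) w u≡))
  where
  2^j≤u = <⇒≤ (≰⇒> u≰)
  u≡ : u ∸ 2 ^ j + w ≡ 2 ^ j
  u≡ = +-cancelˡ-≡ (2 ^ j) _ _ (trans (sym (+-assoc (2 ^ j) _ _))
         (trans (cong (_+ w) (m+[n∸m]≡n 2^j≤u)) (trans eq (cong (2 ^ j +_) (+-identityʳ (2 ^ j))))))

balanced-family : ∀ {p j u w d B} → Balanced p j u w → d ≡ total p u w + suc j →
  2 * B + squares p u w ≡ total p u w * total p u w + 6 * total p u w → NeighborlyFamily B d
balanced-family {p} {j} {u} {w} {d} {B} X d≡ B≡ = subst₂ NeighborlyFamily size≡B dim≡d (family code)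
  where
  open Balanced X
  dim≡d : dim + (j + 2) ≡ d
  dim≡d = trans (regroup dim j) (trans (cong (_+ suc j) dim-total) (sym d≡))
    where
    regroup : ∀ m j → m + (j + 2) ≡ suc m + suc j
    regroup = solve-∀
  size≡B : size ≡ B
  size≡B = *-cancelˡ-≡ size B 2 (+-cancelʳ-≡ (squares p u w) _ _
    (trans size-total (trans (cong (λ M → M * M + 6 * M) dim-total) (sym B≡))))

-- The sequence a

-- Reduces a strict inequality to a ring identity with explicit slack `k`.
<-witness : ∀ {m n} k → suc m + k ≡ n → m < n
<-witness k eq = ≤-trans (m≤m+n _ k) (≤-reflexive eq)

n<2^n : ∀ n → n < 2 ^ n
n<2^n zero    = s≤s z≤n
n<2^n (suc n) = +-mono-≤ (m^n>0 2 n) (≤-trans (n<2^n n) (m≤m+n _ 0))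

isThreeTwoPow-true : ∀ j → isThreeTwoPow (3 * 2 ^ j) ≡ true
isThreeTwoPow-true j = Equivalence.to T-≡
  (any⁺ _ (lose (∈-upTo⁺ (≤-trans (n<2^n j) (m≤n*m (2 ^ j) 3))) (≡⇒≡ᵇ (3 * 2 ^ j) _ refl)))

-- The bounds place `v` strictly between two consecutive numbers of the form 3·2^r; doubling `v`
-- avoids the exponent j - 1.
isThreeTwoPow-false : ∀ j v → v < 3 * 2 ^ j → 3 * 2 ^ j < 2 * v → isThreeTwoPow v ≡ false
isThreeTwoPow-false j v v< <2v = ¬-not (λ eq → absurd (find (any⁻ _ (upTo v) (Equivalence.from T-≡ eq))))
  where
  absurd : ¬ ∃ λ r → _ × T ((3 * 2 ^ r) ≡ᵇ v)
  absurd (r , _ , t) with ≡ᵇ⇒≡ (3 * 2 ^ r) v t | j ≤? r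
  ... | refl | yes j≤r = <⇒≱ v< (*-monoʳ-≤ 3 (^-monoʳ-≤ 2 j≤r))
  ... | refl | no j≰r  = <⇒≱ <2v (≤-trans (≤-reflexive (swap (2 ^ r))) (*-monoʳ-≤ 3 (^-monoʳ-≤ 2 (≰⇒> j≰r))))
    where
    swap : ∀ x → 2 * (3 * x) ≡ 3 * (2 * x)
    swap = solve-∀

step : ℕ × Bool → ℕ × Bool
step (m , used) = if isThreeTwoPow m ∧ not used then (m , true) else (suc m , false)

state : ℕ → ℕ × Bool
state = fold (2 , false) step

-- `aux` steps the initial state before recursing, whereas `fold` steps the final one.
fold-shift : ∀ {A : Set} (z : A) (f : A → A) n → fold (f z) f n ≡ f (fold z f n)
fold-shift z f zero    = refl
fold-shift z f (suc n) = cong f (fold-shift z f n)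

aux-fold : ∀ k m used → aux k m used ≡ proj₁ (fold (m , used) step k)
aux-fold zero    m used = refl
aux-fold (suc k) m used = trans aux-step (cong proj₁ (fold-shift (m , used) step k))
  where
  aux-step : aux (suc k) m used ≡ proj₁ (fold (step (m , used)) step k)
  aux-step with isThreeTwoPow m ∧ not used
  ... | true  = aux-fold k m true
  ... | false = aux-fold k (suc m) false

-- `state n` carries a(n + 1), the last summand of b(n + 3).
b-suc : ∀ n → b (3 + n) ≡ b (2 + n) + proj₁ (state n)
b-suc n = cong (λ x → 4 + x) (trans (cong (sum ∘ map f) (sym (upTo-∷ʳ n)))
  (trans (cong sum (map-++ f (upTo n) (n ∷ [])))
  (trans (sum-++ (map f (upTo n)) (f n ∷ []))
         (cong (sum (map f (upTo n)) +_) (trans (+-identityʳ _) (aux-fold n 2 false))))))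
  where
  f : ℕ → ℕ
  f k = a (suc k)

step-true : ∀ {v} → isThreeTwoPow v ≡ true → step (v , false) ≡ (v , true)
step-true eq rewrite eq = refl

step-used : ∀ {v} → isThreeTwoPow v ≡ true → step (v , true) ≡ (suc v , false)
step-used eq rewrite eq = refl

step-false : ∀ {v} → isThreeTwoPow v ≡ false → step (v , false) ≡ (suc v , false)
step-false eq rewrite eq = refl

-- The position of d = n + 2 within the growth of a tree of depth j: leaf sizes 2 and 3
-- (lower), or 3 and 4 (upper).  In the upper phase M = 3·2^j occurs with state
-- (M , true), the other M with (M , false); only the successor state matters.
data Phase (n : ℕ) : Set where
  lower : ∀ j u w → let M = total 1 u (suc w) in
    u + suc w ≡ 2 ^ j → state n ≡ (suc M , false) → 2 + n ≡ M + suc j →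
    2 * b (2 + n) + squares 1 u (suc w) ≡ M * M + 6 * M → Phase n
  upper : ∀ j u w → let M = total 2 u w in
    u + w ≡ 2 ^ j → proj₁ (state n) ≡ M → state (suc n) ≡ (suc M , false) → 2 + n ≡ M + suc j →
    2 * b (2 + n) + squares 2 u w ≡ M * M + 6 * M → Phase n

-- Here `c` is the increment of M² + 6M. The size equation persists when twice the new term plus the
-- change of the sum of squares equals `c`.
grow : ∀ n c M M′ {v Q Q′} → 2 * v + Q′ ≡ c + Q → c + (M * M + 6 * M) ≡ M′ * M′ + 6 * M′ →
  proj₁ (state n) ≡ v → 2 * b (2 + n) + Q ≡ M * M + 6 * M → 2 * b (3 + n) + Q′ ≡ M′ * M′ + 6 * M′
grow n c M M′ {v} {Q} {Q′} Q≡ M≡ v≡ eq = begin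
  2 * b (3 + n) + Q′              ≡⟨ cong (λ x → 2 * x + Q′) (trans (b-suc n) (cong (b (2 + n) +_) v≡)) ⟩
  2 * (b (2 + n) + v) + Q′        ≡⟨ regroup (b (2 + n)) v Q′ ⟩
  2 * b (2 + n) + (2 * v + Q′)    ≡⟨ cong (2 * b (2 + n) +_) Q≡ ⟩
  2 * b (2 + n) + (c + Q)         ≡⟨ swap (2 * b (2 + n)) c Q ⟩
  c + (2 * b (2 + n) + Q)         ≡⟨ cong (c +_) eq ⟩
  c + (M * M + 6 * M)             ≡⟨ M≡ ⟩
  M′ * M′ + 6 * M′                ∎
  where
  open ≡-Reasoning
  regroup : ∀ x v q → 2 * (x + v) + q ≡ 2 * x + (2 * v + q)
  regroup = solve-∀
  swap : ∀ x c q → x + (c + q) ≡ c + (x + q)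
  swap = solve-∀

square-suc : ∀ M {M′} → M′ ≡ suc M → (2 * M + 7) + (M * M + 6 * M) ≡ M′ * M′ + 6 * M′
square-suc M refl = ring M
  where
  ring : ∀ M → (2 * M + 7) + (M * M + 6 * M) ≡ suc M * suc M + 6 * suc M
  ring = solve-∀

-- Changes of M and of the sum of squares when a leaf grows or all leaves split

lower-M : ∀ u w → 2 * suc w + 3 * suc u ≡ suc (2 * suc (suc w) + 3 * u)
lower-M = solve-∀

turn-M : ∀ u → 3 * suc u + 4 * 0 ≡ suc (2 * 1 + 3 * u)
turn-M = solve-∀

upper-M : ∀ u w → 3 * w + 4 * suc u ≡ suc (3 * suc w + 4 * u)
upper-M = solve-∀

split-M : ∀ u → 2 * suc (u + suc u) + 3 * 0 ≡ 3 * 0 + 4 * suc u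
split-M = solve-∀

-- Growth from 2 to 3 adds 5 to the squares; of the increment 2M + 7 this leaves twice the term M +
-- 1.
lower-Q : ∀ u w → 2 * suc (2 * suc (suc w) + 3 * u) + (4 * suc w + 9 * suc u) ≡
  (2 * (2 * suc (suc w) + 3 * u) + 7) + (4 * suc (suc w) + 9 * u)
lower-Q = solve-∀

turn-Q : ∀ u → 2 * suc (2 * 1 + 3 * u) + (9 * suc u + 16 * 0) ≡ (2 * (2 * 1 + 3 * u) + 7) + (4 * 1 + 9 * u)
turn-Q = solve-∀

-- Growth from 3 to 4 adds 7 to the squares, so now the term is M itself.
upper-Q : ∀ u w → 2 * (3 * suc w + 4 * u) + (9 * w + 16 * suc u) ≡ (2 * (3 * suc w + 4 * u) + 7) + (9 * suc w + 16 * u)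
upper-Q = solve-∀

split-Q : ∀ u → 2 * (3 * 0 + 4 * suc u) + (4 * suc (u + suc u) + 9 * 0) ≡ 9 * 0 + 16 * suc u
split-Q = solve-∀

-- With N = 2^j leaves, M = 2N + u and u ≤ N - 2, so M + 1 lies strictly between 3N/2 and 3N.
lower-not-three : ∀ j u w → u + suc (suc w) ≡ 2 ^ j → isThreeTwoPow (suc (total 1 u (suc (suc w)))) ≡ false
lower-not-three j u w eq = isThreeTwoPow-false j _
  (<-witness w (trans (below u w) (cong (3 *_) eq)))
  (<-witness (w + 3 + 3 * u) (trans (cong (λ N → suc (3 * N) + (w + 3 + 3 * u)) (sym eq)) (above u w)))
  where
  below : ∀ u w → suc (suc (2 * suc (suc w) + 3 * u)) + w ≡ 3 * (u + suc (suc w))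
  below = solve-∀
  above : ∀ u w → suc (3 * (u + suc (suc w))) + (w + 3 + 3 * u) ≡ 2 * suc (2 * suc (suc w) + 3 * u)
  above = solve-∀

-- With N = 2^j leaves, 3N < M ≤ 4N < 6N; hence the exponent `suc j`.
upper-not-three : ∀ j u w → suc u + w ≡ 2 ^ j → isThreeTwoPow (total 2 (suc u) w) ≡ false
upper-not-three j u w eq = isThreeTwoPow-false (suc j) (total 2 (suc u) w)
  (<-witness (3 * w + 2 * u + 1) (trans (below u w) (cong (λ N → 3 * (2 * N)) eq)))
  (<-witness (2 * u + 1) (trans (cong (λ N → suc (3 * (2 * N)) + (2 * u + 1)) (sym eq)) (above u w)))
  where
  below : ∀ u w → suc (3 * w + 4 * suc u) + (3 * w + 2 * u + 1) ≡ 3 * (2 * (suc u + w))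
  below = solve-∀
  above : ∀ u w → suc (3 * (2 * (suc u + w))) + (2 * u + 1) ≡ 2 * (3 * w + 4 * suc u)
  above = solve-∀

next : ∀ {n} → Phase n → Phase (suc n)
next {n} (lower j u (suc w) N≡ state≡ d≡ B≡) =
  lower j (suc u) w (trans (sym (+-suc u (suc w))) N≡)
    (trans (cong step state≡) (trans (step-false (lower-not-three j u w N≡)) (cong (λ M → suc M , false) (sym (lower-M u w)))))
    (trans (cong suc d≡) (cong (_+ suc j) (sym (lower-M u w))))
    (grow n (2 * M + 7) M (total 1 (suc u) (suc w)) (lower-Q u w) (square-suc M (lower-M u w)) (cong proj₁ state≡) B≡)
  where M = total 1 u (suc (suc w))
-- The last leaf of size 2 grows and M becomes 3·2^j. This value is listed twice: as the term of
-- this step and as the first term of the upper phase.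
next {n} (lower j u zero N≡ state≡ d≡ B≡) =
  upper j 0 (suc u) N≡′ (trans (cong proj₁ state′≡) (sym (turn-M u)))
    (trans (cong step state′≡) (trans (step-used three) (cong (λ M → suc M , false) (sym (turn-M u)))))
    (trans (cong suc d≡) (cong (_+ suc j) (sym (turn-M u))))
    (grow n (2 * M + 7) M (total 2 0 (suc u)) (turn-Q u) (square-suc M (turn-M u)) (cong proj₁ state≡) B≡)
  where
  M = total 1 u 1
  N≡′ : suc u ≡ 2 ^ j
  N≡′ = trans (+-comm 1 u) N≡
  three : isThreeTwoPow (suc (total 1 u 1)) ≡ true
  three = trans (cong isThreeTwoPow (trans (sym (turn-M u)) (trans (+-identityʳ _) (cong (3 *_) N≡′)))) (isThreeTwoPow-true j)
  state′≡ : state (suc n) ≡ (suc (total 1 u 1) , true)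
  state′≡ = trans (cong step state≡) (step-true three)
next {n} (upper j u (suc w) N≡ value≡ state≡ d≡ B≡) =
  upper j (suc u) w N≡′ (cong proj₁ state′≡) (trans (cong step state′≡) (step-false (upper-not-three j u w N≡′)))
    (trans (cong suc d≡) (cong (_+ suc j) (sym (upper-M u w))))
    (grow n (2 * M + 7) M (total 2 (suc u) w) (upper-Q u w) (square-suc M (upper-M u w)) value≡ B≡)
  where
  M = total 2 u (suc w)
  N≡′ : suc u + w ≡ 2 ^ j
  N≡′ = trans (sym (+-suc u w)) N≡
  state′≡ : state (suc n) ≡ (total 2 (suc u) w , false)
  state′≡ = trans state≡ (cong (_, false) (sym (upper-M u w)))
-- All leaves have size 4 and split into pairs of size 2. M is unchanged, so the extra dimension
-- comes from the depth alone.
next {n} (upper j (suc u) zero N≡ value≡ state≡ d≡ B≡) =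
  lower (suc j) 0 (u + suc u) (trans (double u) (cong (2 *_) N≡))
    (trans state≡ (cong (λ M → suc M , false) (sym (split-M u))))
    (trans (cong suc d≡) (trans (sym (+-suc (total 2 (suc u) 0) (suc j))) (cong (_+ suc (suc j)) (sym (split-M u)))))
    (grow n 0 (total 2 (suc u) 0) (total 1 0 (suc (u + suc u))) (split-Q u) (cong (λ M → M * M + 6 * M) (sym (split-M u))) value≡ B≡)
  where
  double : ∀ u → suc (u + suc u) ≡ 2 * (suc u + 0)
  double = solve-∀
next {n} (upper j zero zero N≡ value≡ state≡ d≡ B≡) = contradiction N≡ (<⇒≢ (m^n>0 2 j))

-- The growth starts in dimension 3 with a single leaf of size 2, which has 6 = b(3) words.
phase : ∀ n → Phase (suc n)
phase zero    = lower 0 0 0 refl refl refl refl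
phase (suc n) = next (phase n)

phase-family : ∀ {n} → Phase n → NeighborlyFamily (b (2 + n)) (2 + n)
phase-family (lower j u w N≡ _ d≡ B≡)   = balanced-family (balanced 1 j u (suc w) N≡) d≡ B≡
phase-family (upper j u w N≡ _ _ d≡ B≡) = balanced-family (balanced 2 j u w N≡) d≡ B≡

theorem4 : (d : ℕ) → d ≥ 2 →
    Σ (Fin (b d) → Box d) (λ F → ∀ i j → i ≢ j → Neighborly 2 d (F i) (F j))
theorem4 (suc zero)          (s≤s ())
-- The four unit squares of a 2 by 2 grid.
theorem4 (suc (suc zero))    _ = family (leaf 1 1)
theorem4 (suc (suc (suc n))) _ = phase-family (phase n)
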